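{- Let $k,d,N \geq 2$ be three positive integers. Then there exists a depth-$d$ monotone majority circuit of size (at most) $2^{6 (N^{1/d} \log k + \log N)}$ that computes $U_{k,N}$.
   Context: Logarithms are base $2$. For a positive integer $t$, $[t]=\{1,\dots,t\}$. For $k\ge 2$ and $N\ge 1$, the Boolean function $U_{k,N}:\{0,1\}^{k\times N}\to\{0,1\}$ is defined as follows: for $x=(x_{i,j})_{i\in[k],j\in[N]}$, put $\mathsf{SUM}(x)=\sum_{j=1}^{N}2^{N-j}(x_{1,j}+\cdots+x_{k,j})$, and let $U_{k,N}(x)=1$ if $\mathsf{SUM}(x)\ge 2^N$ and $U_{k,N}(x)=0$ otherwise. A monotone majority circuit is a directed acyclic graph which may have multiple edges (called wires), with a single node with no outgoing wires, called the output gate. Nodes with no incoming wires are input nodes, each labeled $0$, $1$ or one of the input variables. Every other node (gate) is labeled with a monotone unweighted threshold gate $\mathsf{THR}_{t,m}$ for some integer $t$, where $m$ is its in-degree (counted with multiplicity); it outputs $1$ iff at least $t$ of its $m$ input wires carry the value $1$. The size of a gate $\mathsf{THR}_{t,m}$ is $m$, and the size of a circuit is the sum of the sizes of its gates (i.e. its number of wires). Depth is the maximum number of gates on a directed path from an input node to the output gate (so a depth-$1$ circuit is a single threshold gate applied to input nodes); a depth-$d$ circuit is one of depth at most $d$. -}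

module Defs where

open import Data.Bool using (Bool; if_then_else_)
open import Data.Fin using (Fin; toℕ)
open import Data.Fin.Induction using (spo-wellFounded)
open import Data.Integer as ℤ using (ℤ; +_; ∣_∣)
open import Data.List using (List; []; length; map)
open import Data.List.Membership.Propositional using (_∈_; mapWith∈)
open import Data.List.Membership.Propositional.Properties using (mapWith∈-cong; mapWith∈≗map)
open import Data.List.NonEmpty using (List⁺; toList)
open import Data.Nat as ℕ using (ℕ; suc; _∸_)
import Data.Nat.ListAction as ListAction
open import Data.Nat.Properties using (+-0-monoid)
open import Data.Product using (_×_; _,_; ∃₂; ∃-syntax)
open import Data.Rational.Unnormalised as ℚ using (ℚᵘ; 0ℚᵘ; ↥_; ↧ₙ_)
open import Function using (_⇔_)
open import Induction.WellFounded using (WellFounded; WfRec; module All; module FixPoint)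
open import Level using (0ℓ)
open import Relation.Binary.Construct.Closure.ReflexiveTransitive using (Star; ε; _◅_)
open import Relation.Binary.Construct.Closure.Transitive using (TransClosure; _++_; wellFounded⁻)
open import Relation.Binary.PropositionalEquality
  using (_≡_; refl; trans; cong; isEquivalence; resp₂)
open import Relation.Nullary using (¬_)
open import Relation.Nullary.Decidable using (⌊_⌋)

open import Algebra.Properties.Monoid.Sum +-0-monoid using (sum-syntax)
open import Algebra.Definitions.RawSemiring ℚ.+-*-rawSemiring using () renaming (_^_ to _^ℚ_)

bit : Bool → ℕ
bit b = if b then 1 else 0

------------------------------------------------------------------------
-- The function U

-- Indices are 0-based, so the column j ∈ {1,…,N} is toℕ j + 1 here.
SUM : (k N : ℕ) → (Fin k × Fin N → Bool) → ℕ
SUM k N x = ∑[ j < N ] (2 ℕ.^ (N ∸ suc (toℕ j)) ℕ.* (∑[ i < k ] bit (x (i , j))))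

U : (k N : ℕ) → (Fin k × Fin N → Bool) → Bool
U k N x = ⌊ 2 ℕ.^ N ℕ.≤? SUM k N x ⌋

------------------------------------------------------------------------
-- Monotone majority circuits over a set V of variables

data Input (V : Set) : Set where
  const : Bool → Input V
  var   : V → Input V

-- A gate carries its threshold and the list of the sources of its incoming
-- wires (a source occurs once per parallel wire). The list is nonempty since
-- a node without incoming wires is an input node.
data Node (V : Set) (n : ℕ) : Set where
  input : Input V → Node V n
  gate  : (t : ℤ) → List⁺ (Fin n) → Node V n

sources : ∀ {V n} → Node V n → List (Fin n)
sources (input _)   = []
sources (gate _ us) = toList us

inDegree : ∀ {V n} → Node V n → ℕ
inDegree nd = length (sources nd)

gateCount : ∀ {V n} → Node V n → ℕ
gateCount (input _)  = 0
gateCount (gate _ _) = 1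

THR : ℤ → List Bool → Bool
THR t bs = ⌊ t ℤ.≤? + ListAction.sum (map bit bs) ⌋

record Circuit (V : Set) : Set where
  field
    order : ℕ
    node  : Fin order → Node V order

  _⟶_ : Fin order → Fin order → Set
  u ⟶ v = u ∈ sources (node v)

  field
    acyclic    : ∀ u → ¬ TransClosure _⟶_ u u
    output     : Fin order
    uniqueSink : ∀ u → (∀ v → ¬ (u ⟶ v)) ⇔ u ≡ output

  size : ℕ
  size = ∑[ u < order ] inDegree (node u)

  gatesOn : ∀ {u v} → Star _⟶_ u v → ℕ
  gatesOn {u} ε       = gateCount (node u)
  gatesOn {u} (_ ◅ p) = gateCount (node u) ℕ.+ gatesOn p

  Depth≤ : ℕ → Set
  Depth≤ d = ∀ {u i} → node u ≡ input i → (p : Star _⟶_ u output) → gatesOn p ℕ.≤ d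

  ⟶-wellFounded : WellFounded _⟶_
  ⟶-wellFounded = wellFounded⁻ _⟶_ (spo-wellFounded record
    { isEquivalence = isEquivalence
    ; irrefl        = λ { {u} refl p → acyclic u p }
    ; trans         = _++_
    ; <-resp-≈      = resp₂ (TransClosure _⟶_)
    })

  module _ (x : V → Bool) where

    nodeValue : (nd : Node V order) → (∀ {u} → u ∈ sources nd → Bool) → Bool
    nodeValue (input (const b)) _  = b
    nodeValue (input (var v))   _  = x v
    nodeValue (gate t us)       ih = THR t (mapWith∈ (toList us) ih)

    valueStep : ∀ v → WfRec _⟶_ (λ _ → Bool) v → Bool
    valueStep v = nodeValue (node v)

    value : Fin order → Bool
    value = All.wfRec ⟶-wellFounded 0ℓ (λ _ → Bool) valueStep

    private
      nodeValue-ext : ∀ nd {ih ih′ : ∀ {u} → u ∈ sources nd → Bool} →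
                      (∀ {u} (e : u ∈ sources nd) → ih e ≡ ih′ e) →
                      nodeValue nd ih ≡ nodeValue nd ih′
      nodeValue-ext (input (const _)) _  = refl
      nodeValue-ext (input (var _))   _  = refl
      nodeValue-ext (gate t us)       eq = cong (THR t) (mapWith∈-cong (toList us) _ _ eq)

    value-unfold : ∀ v → value v ≡ nodeValue (node v) (λ {u} _ → value u)
    value-unfold v = FixPoint.unfold-wfRec ⟶-wellFounded (λ _ → Bool) valueStep
                       (λ u → nodeValue-ext (node u))

    value-gate : ∀ v {t us} → node v ≡ gate t us → value v ≡ THR t (map value (toList us))
    value-gate v {t} {us} eq =
      trans (value-unfold v)
        (trans (cong (λ nd → nodeValue nd (λ {u} _ → value u)) eq)
               (cong (THR t) (mapWith∈≗map value (toList us))))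

  Computes : ((V → Bool) → Bool) → Set
  Computes f = ∀ x → value x output ≡ f x

------------------------------------------------------------------------
-- Nonnegative reals

-- A real y ≥ 0 is represented by its upper cut, the set {r ∈ ℚ | y < r}.
ℝ≥0 : Set₁
ℝ≥0 = ℚᵘ → Set

infix  4 _≤ʳ_
infixl 6 _+ʳ_
infixl 7 _*ʳ_

_≤ʳ_ : ℝ≥0 → ℝ≥0 → Set
x ≤ʳ y = ∀ r → y r → x r

fromℕ : ℕ → ℝ≥0
fromℕ n r = (+ n ℚ./ 1) ℚ.< r

_+ʳ_ : ℝ≥0 → ℝ≥0 → ℝ≥0
(x +ʳ y) r = ∃₂ λ s t → x s × y t × s ℚ.+ t ℚ.≤ r

_*ʳ_ : ℝ≥0 → ℝ≥0 → ℝ≥0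
(x *ʳ y) r = ∃₂ λ s t → x s × y t × s ℚ.* t ℚ.≤ r

-- n^(1/d), for d ≥ 1.
root : (d n : ℕ) → ℝ≥0
root d n r = 0ℚᵘ ℚ.≤ r × (+ n ℚ./ 1) ℚ.< r ^ℚ d

-- The binary logarithm of n ≥ 1: for r = p/q ≥ 0, log n < r iff n^q < 2^p.
log : ℕ → ℝ≥0
log n r = 0ℚᵘ ℚ.≤ r × n ℕ.^ (↧ₙ r) ℕ.< 2 ℕ.^ ∣ ↥ r ∣

-- 2^y: a rational r ≥ 0 lies above it iff 2^(p/q) ≤ r, that is 2^p ≤ r^q, for
-- some rational p/q > y. All elements p/q of a cut are positive, so |p| = p.
2^_ : ℝ≥0 → ℝ≥0
(2^ y) r = 0ℚᵘ ℚ.≤ r ×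
  ∃[ s ] (y s × (+ (2 ℕ.^ ∣ ↥ s ∣) ℚ./ 1) ℚ.≤ r ^ℚ (↧ₙ s))

{-# OPTIONS --safe #-}

-- A base-Q sum s of n digits overflows iff the deficiency D₀ = 1,
-- Dⱼ₊₁ = Q Dⱼ − sⱼ ends at most 0. When every digit is at most k (Q − 1), a
-- deficiency that is ≤ 0 or ≥ k stays so, hence only min (max D 0) k matters.
-- If Q ≥ k, then at most one deficiency in 1 … k − 1 is sent into that interval
-- by a given digit, so the digit acts on the clipped deficiencies like one of
-- k (k − 1) + 1 maps forming a chain, namely those of the digits 0 … k (k − 1) in
-- base k. One layer of threshold gates on blocks of m digits in base B, with
-- Q = B^m, thus produces digits in base k, in unary, that are m times fewer.
-- Starting from base 2 with blocks of m ⌊log k⌋ columns, and taking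
-- m = ⌈N^(1/d)⌉, at most d layers suffice; a gate has at most k^(m+1) wires.
module Submission where

open import Defs
open import Data.Bool using (Bool; true; false)
open import Data.Fin
  using (Fin; zero; suc; toℕ; fromℕ<; _↑ˡ_; _↑ʳ_; splitAt; combine; remQuot)
open import Data.Fin.Properties
  using (toℕ<n; splitAt-↑ˡ; splitAt-↑ʳ; splitAt⁻¹-↑ˡ; splitAt⁻¹-↑ʳ; remQuot-combine; combine-surjective)
open import Data.Integer as ℤ using ()
import Data.Integer.Properties as ℤₚ
open import Data.List using (List; []; _∷_; _++_; length; map; concat; replicate; tabulate)
open import Data.List.Membership.Propositional using (_∈_)
open import Data.List.Membership.Propositional.Properties
  using (∈-map⁺; ∈-map⁻; ∈-++⁺ˡ; ∈-++⁺ʳ; ∈-tabulate⁺; mapWith∈≗map)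
open import Data.List.NonEmpty as List⁺ using (List⁺; toList)
open import Data.List.Properties using (map-∘; map-cong; map-cong-local; map-++; length-map)
import Data.List.Relation.Unary.All as All
open import Data.Nat
open import Data.Nat.Divisibility using (n∣m*n)
open import Data.Nat.DivMod using (/-monoˡ-≤; +-distrib-/-∣ˡ; m*n/n≡m; m<n⇒m/n≡0)
import Data.Nat.ListAction as ListAction
open import Data.Nat.ListAction.Properties using () renaming (sum-++ to sumᴸ-++)
open import Data.Nat.Properties
open import Data.Nat.Tactic.RingSolver using (solve-∀)
open import Data.Product using (_×_; _,_; ∃-syntax; proj₁; proj₂)
open import Data.Rational.Unnormalised as ℚ using (ℚᵘ; mkℚᵘ; 0ℚᵘ; ↥_; ↧ₙ_)
import Data.Rational.Unnormalised.Properties as ℚₚ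
open import Data.Sum using (_⊎_; inj₁; inj₂; [_,_]′)
open import Data.Unit using (⊤)
open import Function using (_∘_; _⇔_; mk⇔; Equivalence)
open import Function.Properties.Equivalence
  using () renaming (refl to ⇔-refl; sym to ⇔-sym; trans to ⇔-trans)
open import Induction.WellFounded using (Acc; acc)
open import Relation.Binary.Construct.Closure.ReflexiveTransitive using (Star; ε; _◅_)
open import Relation.Binary.Construct.Closure.Transitive using (TransClosure; [_]; _∷_)
open import Relation.Binary.PropositionalEquality
  using (_≡_; refl; sym; trans; cong; cong₂; subst; subst₂; module ≡-Reasoning)
open import Relation.Nullary using (¬_; Dec; yes; no; contradiction)
open import Relation.Nullary.Decidable using (⌊_⌋)
open import Algebra.Definitions.RawSemiring ℚ.+-*-rawSemiring using () renaming (_^_ to _^ℚ_)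
open import Algebra.Properties.Monoid.Sum +-0-monoid
  using (sum-syntax; sum-cong-≗; sum-replicate-zero)

open Equivalence using (to; from)

private variable
  V A : Set
  P Q : Set
  m n w w′ : ℕ

-- Layered circuits

-- Every gate reads only the layer directly below, so acyclicity and depth are read off from the
-- number of layers. Parallel wires are repetitions in the list.
data Layered (V : Set) : ℕ → Set where
  inputs : (Fin w → Input V) → Layered V w
  layer  : Layered V w → (Fin w′ → ℕ × List⁺ (Fin w)) → Layered V w′

height : Layered V w → ℕ
height (inputs _)  = 0
height (layer l _) = suc (height l)

wires : Layered V w → ℕ
wires (inputs _)            = 0
wires (layer {w′ = w′} l g) = (∑[ i < w′ ] length (toList (proj₂ (g i)))) + wires l

inputValue : (V → Bool) → Input V → Bool
inputValue x (const b) = b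
inputValue x (var v)   = x v

eval : Layered V w → (V → Bool) → Fin w → Bool
eval (inputs f)  x i = inputValue x (f i)
eval (layer l g) x i = THR (ℤ.+ proj₁ (g i)) (map (eval l x) (toList (proj₂ (g i))))

-- The unique-sink condition of `Circuit`, layer by layer: each node below the last layer has to
-- feed some gate.
Covered : Layered V w → Set
Covered (inputs _)  = ⊤
Covered (layer l g) = (∀ i → ∃[ j ] (i ∈ toList (proj₂ (g j)))) × Covered l

-- Translation of a layered circuit into a directed acyclic graph.

order : Layered V w → ℕ
order {w = w} (inputs _)  = w
order {w = w} (layer l _) = w + order l

top : (l : Layered V w) → Fin w → Fin (order l)
top (inputs _)  i = i
top (layer l _) i = i ↑ˡ order l

mapSources : (Fin m → Fin n) → Node V m → Node V n
mapSources ρ (input i)   = input i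
mapSources ρ (gate t us) = gate t (List⁺.map ρ us)

node : (l : Layered V w) → Fin (order l) → Node V (order l)
node         (inputs f)  u = input (f u)
node {w = w} (layer l g) u =
  [ (λ i → gate (ℤ.+ proj₁ (g i)) (List⁺.map (λ s → w ↑ʳ top l s) (proj₂ (g i))))
  , (λ v → mapSources (w ↑ʳ_) (node l v))
  ]′ (splitAt w u)

rank : (l : Layered V w) → Fin (order l) → ℕ
rank         (inputs _)  u = 0
rank {w = w} (layer l g) u = [ (λ _ → suc (height l)) , rank l ]′ (splitAt w u)

valuation : (l : Layered V w) → (V → Bool) → Fin (order l) → Bool
valuation         (inputs f)  x u = inputValue x (f u)
valuation {w = w} (layer l g) x u = [ eval (layer l g) x , valuation l x ]′ (splitAt w u)

↑-elim : ∀ m {n} (P : Fin (m + n) → Set) →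
         (∀ i → P (i ↑ˡ n)) → (∀ j → P (m ↑ʳ j)) → ∀ u → P u
↑-elim m P left right u with splitAt m u in eq
... | inj₁ i = subst P (splitAt⁻¹-↑ˡ eq) (left i)
... | inj₂ j = subst P (splitAt⁻¹-↑ʳ {m} eq) (right j)

∑-++ : ∀ m {n} (f : Fin (m + n) → ℕ) →
       (∑[ u < m + n ] f u) ≡ (∑[ i < m ] f (i ↑ˡ n)) + (∑[ j < n ] f (m ↑ʳ j))
∑-++ zero    f = refl
∑-++ (suc m) f = trans (cong (f zero +_) (∑-++ m (f ∘ suc))) (sym (+-assoc (f zero) _ _))

sources-mapSources : (ρ : Fin m → Fin n) (nd : Node V m) →
                     sources (mapSources ρ nd) ≡ map ρ (sources nd)
sources-mapSources ρ (input _)  = refl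
sources-mapSources ρ (gate _ _) = refl

rank-top : (l : Layered V w) (i : Fin w) → rank l (top l i) ≡ height l
rank-top         (inputs _)  i = refl
rank-top {w = w} (layer l _) i rewrite splitAt-↑ˡ w i (order l) = refl

rank≤height : (l : Layered V w) (u : Fin (order l)) → rank l u ≤ height l
rank≤height         (inputs _)  u = z≤n
rank≤height {w = w} (layer l g) u with splitAt w u
... | inj₁ _ = ≤-refl
... | inj₂ v = m≤n⇒m≤1+n (rank≤height l v)

-- Wires only join a layer to the next one. This strict increase yields acyclicity, the fact that
-- the output is a sink, and the depth bound.
rank-edge : (l : Layered V w) {u v : Fin (order l)} →
            u ∈ sources (node l v) → rank l u < rank l v
rank-edge (inputs _) ()
rank-edge {w = w} (layer l g) {u} {v} e with splitAt w v
... | inj₁ i with ∈-map⁻ (λ s → w ↑ʳ top l s) e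
...   | s , _ , refl rewrite splitAt-↑ʳ w (order l) (top l s) | rank-top l s = ≤-refl
rank-edge {w = w} (layer l g) {u} {v} e
    | inj₂ v′ rewrite sources-mapSources (w ↑ʳ_) (node l v′) with ∈-map⁻ (w ↑ʳ_) e
...   | u′ , e′ , refl rewrite splitAt-↑ʳ w (order l) u′ = rank-edge l e′

-- The layer just below the last one is handled by `Covered`, deeper nodes by recursion. When the
-- last layer has width 1, the output is thus the only candidate for a sink.
top-or-source : (l : Layered V w) → Covered l → (u : Fin (order l)) →
                (∃[ i ] (u ≡ top l i)) ⊎ (∃[ v ] (u ∈ sources (node l v)))
top-or-source (inputs _) _ u = inj₁ (u , refl)
top-or-source {V = V} {w = w} (layer l g) (cov , covs) =
  ↑-elim w (λ u → (∃[ i ] (u ≡ i ↑ˡ order l)) ⊎ (∃[ v ] (u ∈ sources (node (layer l g) v))))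
    (λ i → inj₁ (i , refl)) lower
  where
  lower : ∀ u → _
  lower u with top-or-source l covs u
  ... | inj₁ (i , refl) = inj₂ (proj₁ (cov i) ↑ˡ order l , edge)
    where
    edge : w ↑ʳ top l i ∈ sources (node (layer l g) (proj₁ (cov i) ↑ˡ order l))
    edge rewrite splitAt-↑ˡ w (proj₁ (cov i)) (order l) =
      ∈-map⁺ (λ s → w ↑ʳ top l s) (proj₂ (cov i))
  ... | inj₂ (v , e) = inj₂ (w ↑ʳ v , edge)
    where
    edge : w ↑ʳ u ∈ sources (node (layer l g) (w ↑ʳ v))
    edge rewrite splitAt-↑ʳ w (order l) v | sources-mapSources (w ↑ʳ_) (node l v) =
      ∈-map⁺ (w ↑ʳ_) e

∑inDegree≡wires : (l : Layered V w) → (∑[ u < order l ] inDegree (node l u)) ≡ wires l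
∑inDegree≡wires {w = w} (inputs _) = sum-replicate-zero w
∑inDegree≡wires {w = w} (layer l g) =
  trans (∑-++ w (λ u → inDegree (node (layer l g) u)))
    (cong₂ _+_ (sum-cong-≗ upper) (trans (sum-cong-≗ lower) (∑inDegree≡wires l)))
  where
  upper : ∀ i → inDegree (node (layer l g) (i ↑ˡ order l)) ≡ length (toList (proj₂ (g i)))
  upper i rewrite splitAt-↑ˡ w i (order l) = length-map (λ s → w ↑ʳ top l s) (toList (proj₂ (g i)))
  lower : ∀ v → inDegree (node (layer l g) (w ↑ʳ v)) ≡ inDegree (node l v)
  lower v rewrite splitAt-↑ʳ w (order l) v | sources-mapSources (w ↑ʳ_) (node l v) =
    length-map (w ↑ʳ_) (sources (node l v))

-- The counterpart of `nodeValue` without membership proofs: it takes a valuation of all nodes, so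
-- that consistency becomes an equation.
nodeVal : (V → Bool) → (Fin n → Bool) → Node V n → Bool
nodeVal x ν (input i)   = inputValue x i
nodeVal x ν (gate t us) = THR t (map ν (toList us))

nodeVal-mapSources : (x : V → Bool) (ρ : Fin m → Fin n) {ν : Fin n → Bool} {ν′ : Fin m → Bool} →
                     (∀ u → ν (ρ u) ≡ ν′ u) →
                     ∀ nd → nodeVal x ν (mapSources ρ nd) ≡ nodeVal x ν′ nd
nodeVal-mapSources x ρ eq (input _)   = refl
nodeVal-mapSources x ρ eq (gate t us) =
  cong (THR t) (trans (sym (map-∘ (toList us))) (map-cong eq (toList us)))

valuation-top : (l : Layered V w) (x : V → Bool) (i : Fin w) → valuation l x (top l i) ≡ eval l x i
valuation-top         (inputs _)  x i = refl
valuation-top {w = w} (layer l _) x i rewrite splitAt-↑ˡ w i (order l) = refl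

valuation-node : (l : Layered V w) (x : V → Bool) (u : Fin (order l)) →
                 valuation l x u ≡ nodeVal x (valuation l x) (node l u)
valuation-node (inputs _) x u = refl
valuation-node {w = w} (layer l g) x u with splitAt w u
... | inj₁ i = cong (THR (ℤ.+ proj₁ (g i)))
                 (trans (map-cong (λ s → sym (trans (lift (top l s)) (valuation-top l x s))) us) (map-∘ us))
  where
  us = toList (proj₂ (g i))
  lift : ∀ v → valuation (layer l g) x (w ↑ʳ v) ≡ valuation l x v
  lift v rewrite splitAt-↑ʳ w (order l) v = refl
... | inj₂ v = trans (valuation-node l x v) (sym (nodeVal-mapSources x (w ↑ʳ_) lift (node l v)))
  where
  lift : ∀ v → valuation (layer l g) x (w ↑ʳ v) ≡ valuation l x v
  lift v rewrite splitAt-↑ʳ w (order l) v = refl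

module _ (C : Circuit V) where
  open Circuit C hiding (node)

  value-node : ∀ x v → value x v ≡ nodeVal x (value x) (Circuit.node C v)
  value-node x v = trans (value-unfold x v) (unfolded (Circuit.node C v))
    where
    unfolded : ∀ nd → nodeValue x nd (λ {u} _ → value x u) ≡ nodeVal x (value x) nd
    unfolded (input (const _)) = refl
    unfolded (input (var _))   = refl
    unfolded (gate t us)       = cong (THR t) (mapWith∈≗map (value x) (toList us))

  -- Induction along the wires shows that the local equations have at most one solution. The
  -- well-founded recursion behind `value` can therefore be replaced by `valuation`, which recurses
  -- over layers.
  value-unique : ∀ x (ν : Fin (Circuit.order C) → Bool) →
                 (∀ v → ν v ≡ nodeVal x ν (Circuit.node C v)) → ∀ v → value x v ≡ ν v
  value-unique x ν consistent v = go v (⟶-wellFounded v)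
    where
    onSources : ∀ nd → (∀ {u} → u ∈ sources nd → value x u ≡ ν u) →
                nodeVal x (value x) nd ≡ nodeVal x ν nd
    onSources (input _)   _  = refl
    onSources (gate t us) eq = cong (THR t) (map-cong-local (All.tabulate eq))
    go : ∀ v → Acc _⟶_ v → value x v ≡ ν v
    go v (acc rs) = trans (value-node x v)
      (trans (onSources (Circuit.node C v) (λ e → go _ (rs e))) (sym (consistent v)))

module _ (l : Layered V 1) (cov : Covered l) where

  private
    _⟶_ : Fin (order l) → Fin (order l) → Set
    u ⟶ v = u ∈ sources (node l v)

    rank-path : ∀ {u v} → TransClosure _⟶_ u v → rank l u < rank l v
    rank-path [ e ]   = rank-edge l e
    rank-path (e ∷ p) = <-trans (rank-edge l e) (rank-path p)

    top-sink : ∀ v → ¬ (top l zero ⟶ v)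
    top-sink v e = <⇒≱ (rank-edge l e)
      (≤-trans (rank≤height l v) (≤-reflexive (sym (rank-top l zero))))

    sink-top : ∀ u → (∀ v → ¬ (u ⟶ v)) → u ≡ top l zero
    sink-top u sink with top-or-source l cov u
    ... | inj₁ (zero , eq) = eq
    ... | inj₂ (v , e)     = contradiction e (sink v)

  toCircuit : Circuit V
  toCircuit = record
    { order      = order l
    ; node       = node l
    ; acyclic    = λ u p → <-irrefl refl (rank-path p)
    ; output     = top l zero
    ; uniqueSink = λ u → mk⇔ (sink-top u) (λ { refl → top-sink })
    }

  size-toCircuit : Circuit.size toCircuit ≡ wires l
  size-toCircuit = ∑inDegree≡wires l

  value-toCircuit : ∀ x → Circuit.value toCircuit x (top l zero) ≡ eval l x zero
  value-toCircuit x = trans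
    (value-unique toCircuit x (valuation l x) (valuation-node l x) (top l zero))
    (valuation-top l x zero)

  private
    gateCount≤1 : (nd : Node V n) → gateCount nd ≤ 1
    gateCount≤1 (input _)  = z≤n
    gateCount≤1 (gate _ _) = ≤-refl

    -- Each wire raises the rank by at least one, which pays for the gate it leads to. On a path
    -- from an input to the output, the first node counts 0 and the final rank is `height l`.
    gatesOn+rank : ∀ {u v} (p : Star _⟶_ u v) →
                   Circuit.gatesOn toCircuit p + rank l u ≤ gateCount (node l u) + rank l v
    gatesOn+rank ε = ≤-refl
    gatesOn+rank {u} {v} (_◅_ {j = u′} e p) = begin
      c + gs + rank l u                      ≡⟨ +-assoc c gs (rank l u) ⟩
      c + (gs + rank l u)                    ≤⟨ +-monoʳ-≤ c (s≤s⁻¹ gs+rank<) ⟩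
      c + rank l v                           ∎
      where
      open ≤-Reasoning
      c  = gateCount (node l u)
      gs = Circuit.gatesOn toCircuit p
      gs+rank< : gs + rank l u < suc (rank l v)
      gs+rank< = begin-strict
        gs + rank l u                        <⟨ +-monoʳ-< gs (rank-edge l e) ⟩
        gs + rank l u′                       ≤⟨ gatesOn+rank p ⟩
        gateCount (node l u′) + rank l v     ≤⟨ +-monoˡ-≤ (rank l v) (gateCount≤1 (node l u′)) ⟩
        suc (rank l v)                       ∎

  depth-toCircuit : Circuit.Depth≤ toCircuit (height l)
  depth-toCircuit {u} {i} eq p = begin
    Circuit.gatesOn toCircuit p                  ≤⟨ m≤m+n _ (rank l u) ⟩
    Circuit.gatesOn toCircuit p + rank l u       ≤⟨ gatesOn+rank p ⟩
    gateCount (node l u) + rank l (top l zero)   ≡⟨ cong₂ _+_ (cong gateCount eq) (rank-top l zero) ⟩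
    height l                                     ∎
    where open ≤-Reasoning

-- Positional sums and their compression

∑-mono-≤ : ∀ n {f g : Fin n → ℕ} → (∀ i → f i ≤ g i) → (∑[ i < n ] f i) ≤ (∑[ i < n ] g i)
∑-mono-≤ zero    f≤g = z≤n
∑-mono-≤ (suc n) f≤g = +-mono-≤ (f≤g zero) (∑-mono-≤ n (f≤g ∘ suc))

∑-≤ : ∀ n {f : Fin n → ℕ} {b} → (∀ i → f i ≤ b) → (∑[ i < n ] f i) ≤ n * b
∑-≤ zero    f≤b = z≤n
∑-≤ (suc n) f≤b = +-mono-≤ (f≤b zero) (∑-≤ n (f≤b ∘ suc))

-- The leading digit is `c zero`, and digits may exceed `B − 1`.
positional : ℕ → (n : ℕ) → (Fin n → ℕ) → ℕ
positional B n c = ∑[ j < n ] (B ^ (n ∸ suc (toℕ j)) * c j)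

positional-cong : ∀ B n {c c′ : Fin n → ℕ} → (∀ j → c j ≡ c′ j) → positional B n c ≡ positional B n c′
positional-cong B n eq = sum-cong-≗ {n} (λ j → cong (B ^ (n ∸ suc (toℕ j)) *_) (eq j))

positional-++ : ∀ B m n (c : Fin (m + n) → ℕ) →
  positional B (m + n) c ≡ B ^ n * positional B m (c ∘ (_↑ˡ n)) + positional B n (c ∘ (m ↑ʳ_))
positional-++ B zero    n c = cong (_+ positional B n c) (sym (*-zeroʳ (B ^ n)))
positional-++ B (suc m) n c
  rewrite positional-++ B m n (c ∘ suc) | ^-distribˡ-+-* B m n =
    lemma (B ^ m) (B ^ n) (c zero)
      (positional B m (λ j → c (suc (j ↑ˡ n))))
      (positional B n (λ j → c (suc (m ↑ʳ j))))
  where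
  lemma : ∀ p q d x y → p * q * d + (q * x + y) ≡ q * (p * d + x) + y
  lemma = solve-∀

positional-combine : ∀ B m n (c : Fin (n * m) → ℕ) →
  positional B (n * m) c ≡ positional (B ^ m) n (λ j → positional B m (λ i → c (combine j i)))
positional-combine B m zero    c = refl
positional-combine B m (suc n) c =
  trans (positional-++ B m (n * m) c) (cong₂ _+_
    (cong (_* positional B m (λ i → c (i ↑ˡ n * m)))
      (trans (cong (B ^_) (*-comm n m)) (sym (^-*-assoc B m n))))
    (positional-combine B m n (λ u → c (m ↑ʳ u))))

-- Additive form, free of truncated subtraction, of the fact that digits at most `k (B − 1)` give a
-- value at most `k (B ^ n − 1)`. A block of digits thus satisfies the same bound for the base
-- `B ^ n`.
positional+k≤k*B^n : ∀ B k n {c : Fin n → ℕ} → (∀ j → c j + k ≤ k * B) →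
                     positional B n c + k ≤ k * B ^ n
positional+k≤k*B^n B k zero    c≤ = ≤-reflexive (sym (*-identityʳ k))
positional+k≤k*B^n B k (suc n) {c} c≤ = begin
  B ^ n * c zero + p + k       ≡⟨ +-assoc (B ^ n * c zero) p k ⟩
  B ^ n * c zero + (p + k)     ≤⟨ +-monoʳ-≤ (B ^ n * c zero) (positional+k≤k*B^n B k n (c≤ ∘ suc)) ⟩
  B ^ n * c zero + k * B ^ n   ≡⟨ cong (B ^ n * c zero +_) (*-comm k (B ^ n)) ⟩
  B ^ n * c zero + B ^ n * k   ≡⟨ *-distribˡ-+ (B ^ n) (c zero) k ⟨
  B ^ n * (c zero + k)         ≤⟨ *-monoʳ-≤ (B ^ n) (c≤ zero) ⟩
  B ^ n * (k * B)              ≡⟨ lemma (B ^ n) k B ⟩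
  k * (B * B ^ n)              ∎
  where
  open ≤-Reasoning
  p = positional B n (c ∘ suc)
  lemma : ∀ x y z → x * (y * z) ≡ y * (z * x)
  lemma = solve-∀

-- Gates are unweighted, so the weight of a digit is realised by that many parallel wires.
weighted : ℕ → (n : ℕ) → (Fin n → List A) → List A
weighted B zero    f = []
weighted B (suc n) f = concat (replicate (B ^ n) (f zero)) ++ weighted B n (f ∘ suc)

module _ (h : A → ℕ) where
  sum-replicate : ∀ e xs → ListAction.sum (map h (concat (replicate e xs))) ≡ e * ListAction.sum (map h xs)
  sum-replicate zero    xs = refl
  sum-replicate (suc e) xs
    rewrite map-++ h xs (concat (replicate e xs)) | sumᴸ-++ (map h xs) (map h (concat (replicate e xs))) =
      cong (ListAction.sum (map h xs) +_) (sum-replicate e xs)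

  sum-weighted : ∀ B n (f : Fin n → List A) →
    ListAction.sum (map h (weighted B n f)) ≡ positional B n (λ j → ListAction.sum (map h (f j)))
  sum-weighted B zero    f = refl
  sum-weighted B (suc n) f
    rewrite map-++ h (concat (replicate (B ^ n) (f zero))) (weighted B n (f ∘ suc))
          | sumᴸ-++ (map h (concat (replicate (B ^ n) (f zero)))) (map h (weighted B n (f ∘ suc))) =
      cong₂ _+_ (sum-replicate (B ^ n) (f zero)) (sum-weighted B n (f ∘ suc))

  sum-tabulate : ∀ n (f : Fin n → A) → ListAction.sum (map h (tabulate f)) ≡ ∑[ i < n ] h (f i)
  sum-tabulate zero    f = refl
  sum-tabulate (suc n) f = cong (h (f zero) +_) (sum-tabulate n (f ∘ suc))

length≡sum : (xs : List A) → length xs ≡ ListAction.sum (map (λ _ → 1) xs)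
length≡sum []       = refl
length≡sum (x ∷ xs) = cong suc (length≡sum xs)

∈-weighted : ∀ B .{{_ : NonZero B}} n (f : Fin n → List A) i {x} → x ∈ f i → x ∈ weighted B n f
∈-weighted B (suc n) f (suc i) x∈ = ∈-++⁺ʳ (concat (replicate (B ^ n) (f zero))) (∈-weighted B n (f ∘ suc) i x∈)
∈-weighted B (suc n) f zero    x∈ = ∈-++⁺ˡ (go (B ^ n) (m^n>0 B n))
  where
  go : ∀ e → 0 < e → _ ∈ concat (replicate e (f zero))
  go (suc e) _ = ∈-++⁺ˡ x∈

toList⁺ : ∀ {x} (xs : List A) → x ∈ xs → List⁺ A
toList⁺ (x ∷ xs) _ = x List⁺.∷ xs

toList-toList⁺ : ∀ {x} (xs : List A) (x∈ : x ∈ xs) → toList (toList⁺ xs x∈) ≡ xs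
toList-toList⁺ (x ∷ xs) _ = refl

⌊⌋-cong : (P? : Dec P) (Q? : Dec Q) → P ⇔ Q → ⌊ P? ⌋ ≡ ⌊ Q? ⌋
⌊⌋-cong (yes p) (yes q) _ = refl
⌊⌋-cong (no ¬p) (no ¬q) _ = refl
⌊⌋-cong (yes p) (no ¬q) e = contradiction (to e p) ¬q
⌊⌋-cong (no ¬p) (yes q) e = contradiction (from e q) ¬p

THR-ℕ : ∀ t (ν : A → Bool) xs → THR (ℤ.+ t) (map ν xs) ≡ ⌊ t ≤? ListAction.sum (map (bit ∘ ν) xs) ⌋
THR-ℕ t ν xs rewrite sym (map-∘ {g = bit} {f = ν} xs) =
  ⌊⌋-cong (ℤ.+ t ℤ.≤? _) (t ≤? _) (mk⇔ ℤₚ.drop‿+≤+ ℤ.+≤+)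

bit≤1 : ∀ b → bit b ≤ 1
bit≤1 false = z≤n
bit≤1 true  = ≤-refl

bit-⌊⌋-no : (P? : Dec P) → ¬ P → bit ⌊ P? ⌋ ≡ 0
bit-⌊⌋-no (yes p) ¬p = contradiction p ¬p
bit-⌊⌋-no (no _)  _  = refl

-- Threshold counts, and deficiencies clipped at `k`.

count : (ℕ → ℕ) → ℕ → ℕ → ℕ
count θ n s = ∑[ t < n ] bit ⌊ θ (toℕ t) ≤? s ⌋

count≤ : ∀ θ n s → count θ n s ≤ n
count≤ θ n s = ≤-trans (∑-≤ n (λ t → bit≤1 ⌊ θ (toℕ t) ≤? s ⌋)) (≤-reflexive (*-identityʳ n))

-- By monotonicity the thresholds that `s` reaches form an initial segment, so their number tells
-- which ones they are.
i<count⇔θi≤s : ∀ θ → (∀ {i j} → i ≤ j → θ i ≤ θ j) → ∀ n s {i} → i < n → i < count θ n s ⇔ θ i ≤ s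
i<count⇔θi≤s θ mono (suc n) s {i} i<1+n with θ 0 ≤? s
... | no θ0≰s = mk⇔ (λ i<c → contradiction (≤-<-trans z≤n i<c) (≤⇒≯ (≤-reflexive (none n))))
                    (λ θi≤s → contradiction (≤-trans (mono z≤n) θi≤s) θ0≰s)
  where
  none : ∀ n → count (θ ∘ suc) n s ≡ 0
  none n = n≤0⇒n≡0 (≤-trans (∑-≤ n (λ t → ≤-reflexive (bit-⌊⌋-no (θ (suc (toℕ t)) ≤? s)
             (λ θt≤s → θ0≰s (≤-trans (mono z≤n) θt≤s))))) (≤-reflexive (*-zeroʳ n)))
... | yes θ0≤s with i
...   | zero  = mk⇔ (λ _ → θ0≤s) (λ _ → z<s)
...   | suc j = ⇔-trans (mk⇔ s≤s⁻¹ s≤s)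
                        (i<count⇔θi≤s (θ ∘ suc) (mono ∘ s≤s) n s (s≤s⁻¹ i<1+n))

≤-+-⇔-∸ : ∀ {a b c} → a ≤ b + c ⇔ a ∸ b ≤ c
≤-+-⇔-∸ {a} {b} {c} = mk⇔ (m≤n+o⇒m∸n≤o a b) (λ le → ≤-trans (m≤n+m∸n a b) (+-monoʳ-≤ b le))

-- Encodes `min a k ≡ min b k`: all deficiencies from `k` on are identified.
data Clip (k : ℕ) : ℕ → ℕ → Set where
  same  : ∀ {a} → Clip k a a
  large : ∀ {a b} → k ≤ a → k ≤ b → Clip k a b

-- A number below `k` is the least `c` that bounds it, so the tests against all `c < k` recover it;
-- a number that fails all of them is at least `k`.
clip : ∀ {k a b} → (∀ c → c < k → a ≤ c ⇔ b ≤ c) → Clip k a b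
clip {k} {a} {b} h with a <? k | b <? k
... | no a≮k  | no b≮k  = large (≮⇒≥ a≮k) (≮⇒≥ b≮k)
... | yes a<k | _       = same′ (≤-antisym a≤b b≤a)
  where
  b≤a = to (h a a<k) ≤-refl
  a≤b = from (h b (≤-<-trans b≤a a<k)) ≤-refl
  same′ : a ≡ b → Clip k a b
  same′ refl = same
... | no a≮k  | yes b<k = contradiction (≤-<-trans (from (h b b<k) ≤-refl) b<k) a≮k

-- The number `a` is the deficiency, and the contribution of the leading digit is subtracted from
-- both sides. Truncation at 0 is harmless: a deficiency of at most 0 means that the inequality
-- already holds.
positional-step : ∀ a B n (c : Fin (suc n) → ℕ) →
  a * B ^ suc n ≤ positional B (suc n) c ⇔ (a * B ∸ c zero) * B ^ n ≤ positional B n (c ∘ suc)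
positional-step a B n c =
  subst₂ (λ x y → x ≤ positional B (suc n) c ⇔ y ≤ positional B n (c ∘ suc))
    (*-assoc a B (B ^ n))
    (trans (cong (a * B * B ^ n ∸_) (*-comm (B ^ n) (c zero))) (sym (*-distribʳ-∸ (B ^ n) (a * B) (c zero))))
    ≤-+-⇔-∸

module Compression (κ Q : ℕ) (k≤Q : suc κ ≤ Q) where
  private k = suc κ

  -- If suc i ≡ a k − c with c < k, then θ i ≡ a Q − c is the least digit s for which
  -- the deficiency a becomes a Q − s ≤ c.
  θ : ℕ → ℕ
  θ i = suc i + suc (i / k) * (Q ∸ k)

  θ-mono : ∀ {i j} → i ≤ j → θ i ≤ θ j
  θ-mono i≤j = +-mono-≤ (s≤s i≤j) (*-monoˡ-≤ (Q ∸ k) (s≤s (/-monoˡ-≤ k i≤j)))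

  compress : ℕ → ℕ
  compress = count θ (κ * k)

  private
    -- The argument at which `θ` treats the deficiency `suc a` and the bound `c`; the `a` here is
    -- one less than the deficiency.
    index : ℕ → ℕ → ℕ
    index a c = a * k + (κ ∸ c)

    1+index+c : ∀ a c → c < k → suc (index a c) + c ≡ suc a * k
    1+index+c a c c<k = begin
      suc (a * k + (κ ∸ c) + c)    ≡⟨ cong suc (+-assoc (a * k) (κ ∸ c) c) ⟩
      suc (a * k + (κ ∸ c + c))    ≡⟨ cong (λ z → suc (a * k + z)) (m∸n+n≡m (s≤s⁻¹ c<k)) ⟩
      suc (a * k + κ)              ≡⟨ cong suc (+-comm (a * k) κ) ⟩
      suc (κ + a * k)              ∎
      where open ≡-Reasoning

    index/k : ∀ a c → index a c / k ≡ a
    index/k a c = begin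
      (a * k + (κ ∸ c)) / k          ≡⟨ +-distrib-/-∣ˡ (κ ∸ c) (n∣m*n a) ⟩
      a * k / k + (κ ∸ c) / k        ≡⟨ cong₂ _+_ (m*n/n≡m a k) (m<n⇒m/n≡0 (s≤s (m∸n≤m κ c))) ⟩
      a + 0                          ≡⟨ +-identityʳ a ⟩
      a                              ∎
      where open ≡-Reasoning

    θ-index+c : ∀ a c → c < k → θ (index a c) + c ≡ suc a * Q
    θ-index+c a c c<k = begin
      suc i + suc (i / k) * (Q ∸ k) + c      ≡⟨ cong (λ z → suc i + suc z * (Q ∸ k) + c) (index/k a c) ⟩
      suc i + suc a * (Q ∸ k) + c            ≡⟨ lemma (suc i) (suc a * (Q ∸ k)) c ⟩
      suc i + c + suc a * (Q ∸ k)            ≡⟨ cong (_+ suc a * (Q ∸ k)) (1+index+c a c c<k) ⟩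
      suc a * k + suc a * (Q ∸ k)            ≡⟨ *-distribˡ-+ (suc a) k (Q ∸ k) ⟨
      suc a * (k + (Q ∸ k))                  ≡⟨ cong (suc a *_) (m+[n∸m]≡n k≤Q) ⟩
      suc a * Q                              ∎
      where
      open ≡-Reasoning
      i = index a c
      lemma : ∀ x y z → x + y + z ≡ x + z + y
      lemma = solve-∀

  -- A deficiency of at least `k` stays so, as digits are at most `k (Q − 1)` in base `Q` and
  -- `k (k − 1)` in base `k`; the deficiency 0 stays 0. In between, for each `c < k`, both
  -- `suc a * Q ∸ s ≤ c` and `suc a * k ∸ compress s ≤ c` amount to `index a c < compress s`.
  clip-step : ∀ {a a′} s → s + k ≤ k * Q → Clip k a a′ → Clip k (a * Q ∸ s) (a′ * k ∸ compress s)
  clip-step {a} {a′} s s+k≤ (large k≤a k≤a′) =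
    large (m+n≤o⇒m≤o∸n k (≤-trans (≤-reflexive (+-comm k s)) (≤-trans s+k≤ (*-monoˡ-≤ Q k≤a))))
          (m+n≤o⇒m≤o∸n k (≤-trans (+-monoʳ-≤ k (count≤ θ (κ * k) s)) (*-monoˡ-≤ k k≤a′)))
  clip-step {a} s s+k≤ same with k ≤? a
  ... | yes k≤a = clip-step s s+k≤ (large k≤a k≤a)
  clip-step {zero} s s+k≤ same | no _ rewrite 0∸n≡0 s | 0∸n≡0 (compress s) = same
  clip-step {suc a} s s+k≤ same | no k≰1+a = clip λ c c<k →
    ⇔-trans (shift (θ-index+c a c c<k))
      (⇔-trans (⇔-sym (i<count⇔θi≤s θ θ-mono (κ * k) s (index< c c<k)))
        (⇔-sym (shift (1+index+c a c c<k))))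
    where
    shift : ∀ {x y c r} → x + c ≡ y → y ∸ r ≤ c ⇔ x ≤ r
    shift {x} {c = c} {r} refl = ⇔-trans (⇔-sym ≤-+-⇔-∸)
      (mk⇔ (+-cancelʳ-≤ c x r) (+-monoˡ-≤ c))
    -- The deficiency `suc a` is at most `κ`, which is why `κ * k` thresholds suffice.
    index< : ∀ c → c < k → index a c < κ * k
    index< c c<k = ≤-trans (m≤m+n (suc (index a c)) c)
      (≤-trans (≤-reflexive (1+index+c a c c<k)) (*-monoˡ-≤ k (s≤s⁻¹ (≰⇒> k≰1+a))))

  -- Digits are read from the leading one on, with `Clip` between the two deficiencies as the
  -- invariant. At the end, deficiencies so related are both 0 or both positive, because `k > 0`.
  compress-positional : ∀ n {a a′} (s : Fin n → ℕ) → (∀ j → s j + k ≤ k * Q) → Clip k a a′ →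
    a * Q ^ n ≤ positional Q n s ⇔ a′ * k ^ n ≤ positional k n (compress ∘ s)
  compress-positional zero s s+k≤ same = ⇔-refl
  compress-positional zero {a} {a′} s s+k≤ (large k≤a k≤a′) =
    mk⇔ (λ a≤0 → contradiction (≤-trans (≤-reflexive (sym (*-identityʳ a))) a≤0) (<⇒≱ (<-≤-trans z<s k≤a)))
        (λ a≤0 → contradiction (≤-trans (≤-reflexive (sym (*-identityʳ a′))) a≤0) (<⇒≱ (<-≤-trans z<s k≤a′)))
  compress-positional (suc n) {a} {a′} s s+k≤ a~a′ =
    ⇔-trans (positional-step a Q n s)
      (⇔-trans (compress-positional n (s ∘ suc) (s+k≤ ∘ suc) (clip-step (s zero) (s+k≤ zero) a~a′))
        (⇔-sym (positional-step a′ k n (compress ∘ s))))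

  compress-overflow : ∀ n (s : Fin n → ℕ) → (∀ j → s j + k ≤ k * Q) →
    Q ^ n ≤ positional Q n s ⇔ k ^ n ≤ positional k n (compress ∘ s)
  compress-overflow n s s+k≤ =
    subst₂ (λ x y → x ≤ positional Q n s ⇔ y ≤ positional k n (compress ∘ s))
      (*-identityˡ (Q ^ n)) (*-identityˡ (k ^ n)) (compress-positional n {1} s s+k≤ same)

-- Threshold gates on blocks of digits

-- Unary encoding: only the number of ones among the `K` bits counts, so a gate reads the digit
-- through wires of equal multiplicity.
digit : ∀ {n K} → (Fin (n * K) → Bool) → Fin n → ℕ
digit {K = K} b j = ∑[ t < K ] bit (b (combine j t))

sum-weighted-digits : ∀ {A : Set} (h : A → ℕ) B n {K} (f : Fin n → Fin K → A) →
  ListAction.sum (map h (weighted B n (λ j → tabulate (f j)))) ≡ positional B n (λ j → ∑[ t < K ] h (f j t))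
sum-weighted-digits h B n {K} f =
  trans (sum-weighted h B n (λ j → tabulate (f j))) (positional-cong B n (λ j → sum-tabulate h K (f j)))

∑1≡n : ∀ n → (∑[ t < n ] 1) ≡ n
∑1≡n zero    = refl
∑1≡n (suc n) = cong suc (∑1≡n n)

-- The number of wires is the value of the sum when all bits are 1, that is, when every digit equals
-- `K`.
length-weighted : ∀ {A : Set} B k n {K} (f : Fin n → Fin K → A) → K + k ≤ k * B →
  length (weighted B n (λ j → tabulate (f j))) ≤ k * B ^ n
length-weighted B k n {K} f K≤ = begin
  length us                               ≡⟨ length≡sum us ⟩
  ListAction.sum (map (λ _ → 1) us)       ≡⟨ sum-weighted-digits (λ _ → 1) B n f ⟩
  positional B n (λ _ → ∑[ t < K ] 1)     ≡⟨ positional-cong B n (λ _ → ∑1≡n K) ⟩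
  positional B n (λ _ → K)                ≤⟨ m≤m+n _ k ⟩
  positional B n (λ _ → K) + k            ≤⟨ positional+k≤k*B^n B k n (λ _ → K≤) ⟩
  k * B ^ n                               ∎
  where
  open ≤-Reasoning
  us = weighted B n (λ j → tabulate (f j))

digit≤ : ∀ {n K} (b : Fin (n * K) → Bool) j → digit {n} {K} b j ≤ K
digit≤ {K = K} b j = ≤-trans (∑-≤ K (λ t → bit≤1 (b (combine j t)))) (≤-reflexive (*-identityʳ K))

-- The indices `j₀` and `t₀` witness that the list of wires is nonempty.
module Weighted (B : ℕ) .{{_ : NonZero B}} {n K : ℕ} (j₀ : Fin n) (t₀ : Fin K) (f : Fin n → Fin K → A) where
  sourceList : List A
  sourceList = weighted B n (λ j → tabulate (f j))

  ∈-sourceList : ∀ j t → f j t ∈ sourceList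
  ∈-sourceList j t = ∈-weighted B n (λ j → tabulate (f j)) j (∈-tabulate⁺ t)

  gateSources : List⁺ A
  gateSources = toList⁺ sourceList (∈-sourceList j₀ t₀)

  toList-gateSources : toList gateSources ≡ sourceList
  toList-gateSources = toList-toList⁺ sourceList (∈-sourceList j₀ t₀)

  ∈-gateSources : ∀ j t → f j t ∈ toList gateSources
  ∈-gateSources j t = subst (f j t ∈_) (sym toList-gateSources) (∈-sourceList j t)

  length-gateSources : ∀ k → K + k ≤ k * B → length (toList gateSources) ≤ k * B ^ n
  length-gateSources k K≤ =
    subst (λ us → length us ≤ k * B ^ n) (sym toList-gateSources) (length-weighted B k n f K≤)

  THR-gateSources : ∀ θ (ν : A → Bool) →
    THR (ℤ.+ θ) (map ν (toList gateSources)) ≡ ⌊ θ ≤? positional B n (λ j → ∑[ t < K ] bit (ν (f j t))) ⌋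
  THR-gateSources θ ν = trans (cong (THR (ℤ.+ θ) ∘ map ν) toList-gateSources)
    (trans (THR-ℕ θ ν sourceList) (cong (λ s → ⌊ θ ≤? s ⌋) (sum-weighted-digits (bit ∘ ν) B n f)))

-- With `k = suc κ`, the hypothesis on `K` says that a digit of `K` bits is at most `k (B − 1)`, so
-- a block is at most `k (B ^ m − 1)`, as `Compression` requires for `Q = B ^ m`. The index `u₀`
-- shows that each output digit has a bit.
module Reduce (κ B m : ℕ) .{{_ : NonZero B}} (i₀ : Fin m) {K : ℕ} (t₀ : Fin K)
              (k≤B^m : suc κ ≤ B ^ m) (K+k≤k*B : K + suc κ ≤ suc κ * B)
              (u₀ : Fin (κ * suc κ)) where
  open Compression κ (B ^ m) k≤B^m
  private
    k  = suc κ
    K′ = κ * k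
    module Block {n} (j : Fin n) = Weighted B i₀ t₀ (λ i t → combine (combine j i) t)

    -- The gates of block `j` compare its value with all the thresholds `θ`; the number of gates
    -- that fire is `compress` of that value.
    blockGate : ∀ {n} → Fin n × Fin K′ → ℕ × List⁺ (Fin (n * m * K))
    blockGate (j , t) = θ (toℕ t) , Block.gateSources j

  reduce : ∀ n → Layered V (n * m * K) → Layered V (n * K′)
  reduce n l = layer l (blockGate ∘ remQuot {n} K′)

  reduce-covered : ∀ n {l : Layered V (n * m * K)} → Covered l → Covered (reduce n l)
  reduce-covered n cov = covers , cov
    where
    covers : ∀ s → ∃[ u ] (s ∈ toList (proj₂ (blockGate (remQuot {n} K′ u))))
    covers s with combine-surjective {n * m} {K} s
    ... | ji , t , refl with combine-surjective {n} {m} ji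
    -- Every gate of block `j` reads all bits of the block, so any of them will do.
    ...   | j , i , refl = combine j u₀ ,
      subst (λ g → combine (combine j i) t ∈ toList (proj₂ (blockGate g)))
        (sym (remQuot-combine j u₀)) (Block.∈-gateSources j i t)

  wires-reduce : ∀ n (l : Layered V (n * m * K)) → wires (reduce n l) ≤ n * K′ * (k * B ^ m) + wires l
  wires-reduce n l = +-monoˡ-≤ (wires l)
    (∑-≤ (n * K′) (λ u → Block.length-gateSources (proj₁ (remQuot {n} K′ u)) k K+k≤k*B))

  digit-reduce : ∀ n (l : Layered V (n * m * K)) x j →
    digit {n} {K′} (eval (reduce n l) x) j
      ≡ compress (positional B m (λ i → digit {n * m} {K} (eval l x) (combine j i)))
  digit-reduce n l x j = sum-cong-≗ {K′} λ t → cong bit (gate-value t)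
    where
    gate-value : ∀ t → eval (reduce n l) x (combine j t)
      ≡ ⌊ θ (toℕ t) ≤? positional B m (λ i → digit {n * m} {K} (eval l x) (combine j i)) ⌋
    gate-value t = trans
      (cong (λ g → THR (ℤ.+ proj₁ (blockGate g)) (map (eval l x) (toList (proj₂ (blockGate g)))))
        (remQuot-combine j t))
      (Block.THR-gateSources j (θ (toℕ t)) (eval l x))

  -- Grouping into blocks changes the base from `B` to `B ^ m`, and compression then replaces it by
  -- `k`.
  reduce-overflow : ∀ n (l : Layered V (n * m * K)) x →
    B ^ (n * m) ≤ positional B (n * m) (digit {n * m} {K} (eval l x))
      ⇔ k ^ n ≤ positional k n (digit {n} {K′} (eval (reduce n l) x))
  reduce-overflow n l x =
    subst₂ _⇔_
      (cong₂ _≤_ (trans (^-*-assoc B m n) (cong (B ^_) (*-comm m n)))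
                 (sym (positional-combine B m n (digit (eval l x)))))
      (cong (k ^ n ≤_) (sym (positional-cong k n (digit-reduce n l x))))
      (compress-overflow n _ λ j → positional+k≤k*B^n B k m
        (λ i → ≤-trans (+-monoˡ-≤ k (digit≤ (eval l x) (combine j i))) K+k≤k*B))

-- In base `k` with `K = κ * k` bits per digit, `K + k = k * k`, so a reduction reproduces its own
-- hypotheses and can be iterated.
module Complete (κ m : ℕ) (i₀ : Fin m) (u₀ : Fin (κ * suc κ)) where
  private
    k = suc κ
    K = κ * k
    K+k≤k*k : K + k ≤ k * k
    K+k≤k*k = ≤-reflexive (+-comm K k)
    k≤k^m : k ≤ k ^ m
    k≤k^m = ≤-trans (≤-reflexive (sym (*-identityʳ k))) (^-monoʳ-≤ k (≤-<-trans z≤n (toℕ<n i₀)))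
    module R = Reduce κ k m i₀ u₀ k≤k^m K+k≤k*k u₀
    module Final = Weighted k {m} {K} i₀ u₀ combine

  -- This is `m ^ suc r`: after `r` reductions, `m` digits are left for one last gate of threshold
  -- `k ^ m`.
  digits : ℕ → ℕ
  digits zero    = m
  digits (suc r) = digits r * m

  complete : ∀ r → Layered V (digits r * K) → Layered V 1
  complete zero    l = layer l (λ _ → k ^ m , Final.gateSources)
  complete (suc r) l = complete r (R.reduce (digits r) l)

  height-complete : ∀ r (l : Layered V (digits r * K)) → height (complete r l) ≡ suc r + height l
  height-complete zero    l = refl
  height-complete (suc r) l =
    trans (height-complete r (R.reduce (digits r) l)) (+-suc (suc r) (height l))

  complete-covered : ∀ r {l : Layered V (digits r * K)} → Covered l → Covered (complete r l)
  complete-covered zero    cov = covers , cov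
    where
    covers : ∀ s → ∃[ u ] (s ∈ toList Final.gateSources)
    covers s with combine-surjective {m} {K} s
    ... | j , t , refl = zero , Final.∈-gateSources j t
  complete-covered (suc r) cov = complete-covered r (R.reduce-covered (digits r) cov)

  -- A single bound `W` serves all layers, since the number of digits never grows towards the
  -- output.
  wires-complete : ∀ {W} r → digits r * K * (k * k ^ m) ≤ W → (l : Layered V (digits r * K)) →
    wires (complete r l) ≤ suc r * W + wires l
  wires-complete {W = W} zero ≤W l = +-monoˡ-≤ (wires l) (+-monoˡ-≤ 0 (begin
    length (toList Final.gateSources)   ≤⟨ Final.length-gateSources k K+k≤k*k ⟩
    k * k ^ m                           ≡⟨ *-identityˡ (k * k ^ m) ⟨
    1 * (k * k ^ m)                     ≤⟨ *-monoˡ-≤ (k * k ^ m) (*-mono-≤ 1≤m 1≤K) ⟩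
    m * K * (k * k ^ m)                 ≤⟨ ≤W ⟩
    W                                   ∎))
    where
    open ≤-Reasoning
    1≤m : 1 ≤ m
    1≤m = ≤-<-trans z≤n (toℕ<n i₀)
    1≤K : 1 ≤ K
    1≤K = ≤-<-trans z≤n (toℕ<n u₀)
  wires-complete {W = W} (suc r) ≤W l = begin
    wires (complete r (R.reduce (digits r) l))
      ≤⟨ wires-complete r ≤W′ (R.reduce (digits r) l) ⟩
    suc r * W + wires (R.reduce (digits r) l)
      ≤⟨ +-monoʳ-≤ (suc r * W) (R.wires-reduce (digits r) l) ⟩
    suc r * W + (digits r * K * (k * k ^ m) + wires l)
      ≤⟨ +-monoʳ-≤ (suc r * W) (+-monoˡ-≤ (wires l) ≤W′) ⟩
    suc r * W + (W + wires l)
      ≡⟨ +-assoc (suc r * W) W (wires l) ⟨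
    suc r * W + W + wires l
      ≡⟨ cong (_+ wires l) (+-comm (suc r * W) W) ⟩
    suc (suc r) * W + wires l ∎
    where
    open ≤-Reasoning
    digits≤ : digits r ≤ digits r * m
    digits≤ = ≤-trans (≤-reflexive (sym (*-identityʳ (digits r))))
      (*-monoʳ-≤ (digits r) (≤-<-trans z≤n (toℕ<n i₀)))
    ≤W′ : digits r * K * (k * k ^ m) ≤ W
    ≤W′ = ≤-trans (*-monoˡ-≤ (k * k ^ m) (*-monoˡ-≤ K digits≤)) ≤W

  eval-complete : ∀ r (l : Layered V (digits r * K)) x →
    eval (complete r l) x zero
      ≡ ⌊ k ^ digits r ≤? positional k (digits r) (digit {digits r} {K} (eval l x)) ⌋
  eval-complete zero    l x = Final.THR-gateSources (k ^ m) (eval l x)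
  eval-complete (suc r) l x = trans (eval-complete r (R.reduce (digits r) l) x)
    (⌊⌋-cong (_ ≤? _) (_ ≤? _) (⇔-sym (R.reduce-overflow (digits r) l x)))

-- The bound on the size

^-nonNeg : ∀ {p} n → ℚ.NonNegative p → ℚ.NonNegative (p ^ℚ n)
^-nonNeg     zero    p≥0 = _
^-nonNeg {p} (suc n) p≥0 = ℚ.nonNegative (ℚₚ.≤-trans (ℚₚ.≤-reflexive (ℚₚ.≃-sym (ℚₚ.*-zeroˡ 0ℚᵘ)))
  (ℚₚ.*-mono-≤-nonNeg (ℚₚ.nonNegative⁻¹ p {{p≥0}}) (ℚₚ.nonNegative⁻¹ (p ^ℚ n) {{^-nonNeg {p} n p≥0}})))

^ℚ-monoˡ-≤ : ∀ {p q} n → ℚ.NonNegative p → p ℚ.≤ q → p ^ℚ n ℚ.≤ q ^ℚ n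
^ℚ-monoˡ-≤     zero    p≥0 p≤q = ℚₚ.≤-refl
^ℚ-monoˡ-≤ {p} (suc n) p≥0 p≤q =
  ℚₚ.*-mono-≤-nonNeg {{p≥0}} {{^-nonNeg {p} n p≥0}} p≤q (^ℚ-monoˡ-≤ n p≥0 p≤q)

fromℕ-^ : ∀ a n → (ℤ.+ a ℚ./ 1) ^ℚ n ≡ ℤ.+ (a ^ n) ℚ./ 1
fromℕ-^ a zero    = refl
fromℕ-^ a (suc n) rewrite fromℕ-^ a n = cong (ℚ._/ 1) (sym (ℤₚ.pos-* a (a ^ n)))

fromℕ-*-/ : ∀ n a b → (ℤ.+ n ℚ./ 1) ℚ.* mkℚᵘ (ℤ.+ a) b ≡ mkℚᵘ (ℤ.+ (n * a)) b
fromℕ-*-/ n a b = cong₂ mkℚᵘ (sym (ℤₚ.pos-* n a)) (+-identityʳ b)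

/-+-/ : ∀ a b c d → mkℚᵘ (ℤ.+ a) b ℚ.+ mkℚᵘ (ℤ.+ c) d ≡ ℤ.+ (a * suc d + c * suc b) ℚ./ (suc b * suc d)
/-+-/ a b c d = cong (ℚ._/ (suc b * suc d))
  (sym (trans (ℤₚ.pos-+ (a * suc d) (c * suc b)) (cong₂ ℤ._+_ (ℤₚ.pos-* a (suc d)) (ℤₚ.pos-* c (suc b)))))

/-≤⁻ : ∀ {a b c d} .{{_ : NonZero b}} .{{_ : NonZero d}} → (ℤ.+ a ℚ./ b) ℚ.≤ (ℤ.+ c ℚ./ d) → a * d ≤ c * b
/-≤⁻ {a} {suc b} {c} {suc d} (ℚ.*≤* le) =
  ℤₚ.drop‿+≤+ (subst₂ ℤ._≤_ (sym (ℤₚ.pos-* a (suc d))) (sym (ℤₚ.pos-* c (suc b))) le)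

/-<⁻ : ∀ {a b c d} .{{_ : NonZero b}} .{{_ : NonZero d}} → (ℤ.+ a ℚ./ b) ℚ.< (ℤ.+ c ℚ./ d) → a * d < c * b
/-<⁻ {a} {suc b} {c} {suc d} (ℚ.*<* lt) =
  ℤₚ.drop‿+<+ (subst₂ ℤ._<_ (sym (ℤₚ.pos-* a (suc d))) (sym (ℤₚ.pos-* c (suc b))) lt)

/1-≤⁻ : ∀ {a b} → (ℤ.+ a ℚ./ 1) ℚ.≤ (ℤ.+ b ℚ./ 1) → a ≤ b
/1-≤⁻ {a} {b} le = subst₂ _≤_ (*-identityʳ a) (*-identityʳ b) (/-≤⁻ {a} {1} {b} {1} le)

/1-<⁻ : ∀ {a b} → (ℤ.+ a ℚ./ 1) ℚ.< (ℤ.+ b ℚ./ 1) → a < b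
/1-<⁻ {a} {b} lt = subst₂ _<_ (*-identityʳ a) (*-identityʳ b) (/-<⁻ {a} {1} {b} {1} lt)

≤-nonNeg-fraction : ∀ {a b} .{{_ : NonZero b}} s → (ℤ.+ a ℚ./ b) ℚ.≤ s → a * ↧ₙ s ≤ ℤ.∣ ↥ s ∣ * b
≤-nonNeg-fraction {a} {suc b} (mkℚᵘ (ℤ.+ p) q) le = /-≤⁻ {a} {suc b} {p} {suc q} le
≤-nonNeg-fraction {zero} (mkℚᵘ ℤ.-[1+ p ] q) le = z≤n
≤-nonNeg-fraction {suc a} {suc b} (mkℚᵘ ℤ.-[1+ p ] q) (ℚ.*≤* ())

-- An `r < μ` in the cut would give `N < r ^ d ≤ μ ^ d`. Only this lower bound on the root enters
-- the size estimate.
root-≥ : ∀ d {μ N r} → μ ^ d < N → root d N r → (ℤ.+ μ ℚ./ 1) ℚ.≤ r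
root-≥ d {μ} {N} {r} μ^d<N (r≥0 , N<r^d) = ℚₚ.≮⇒≥ λ r<μ → <-asym μ^d<N
  (/1-<⁻ (subst ((ℤ.+ N ℚ./ 1) ℚ.<_) (fromℕ-^ μ d)
    (ℚₚ.<-≤-trans N<r^d (^ℚ-monoˡ-≤ d (ℚ.nonNegative r≥0) (ℚₚ.<⇒≤ r<μ)))))

^-cancelˡ-< : ∀ e {a b} → a ^ e < b ^ e → a < b
^-cancelˡ-< e {a} {b} lt = ≰⇒> λ b≤a → <⇒≱ lt (^-monoˡ-≤ e b≤a)

-- For `S > 0` this is `log S ≤ 6 (log N + μ log k) < p / q`, given `log k < pb / qb` and
-- `log N < pv / qv`. Raising to the power `qb * qv` clears denominators; strictness comes from the
-- factor with `N`.
exponents-< : ∀ {N k S μ} {pb qb pv qv p q} .{{_ : NonZero qb}} .{{_ : NonZero q}} →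
  S ≤ N ^ 6 * k ^ (6 * μ) → k ^ qb < 2 ^ pb → N ^ qv < 2 ^ pv →
  6 * (μ * pb * qv + pv * qb) * q ≤ p * (qb * qv) → S ^ q < 2 ^ p
exponents-< {N} {k} {S} {μ} {pb} {qb} {pv} {qv} {p} {q} S≤ k< N< exp≤ =
  ^-cancelˡ-< (qb * qv) (begin-strict
    (S ^ q) ^ (qb * qv)                             ≡⟨ ^-*-assoc S q (qb * qv) ⟩
    S ^ (q * (qb * qv))                             ≤⟨ ^-monoˡ-≤ (q * (qb * qv)) S≤ ⟩
    (N ^ 6 * k ^ (6 * μ)) ^ (q * (qb * qv))         ≡⟨ ^-distribʳ-* (N ^ 6) (k ^ (6 * μ)) (q * (qb * qv)) ⟩
    (N ^ 6) ^ (q * (qb * qv)) * (k ^ (6 * μ)) ^ (q * (qb * qv))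
      ≡⟨ cong₂ _*_ (regroup N 6 (q * (qb * qv)) qv (6 * (q * qb)) (e₁ q qb qv))
                   (regroup k (6 * μ) (q * (qb * qv)) qb (6 * (μ * (q * qv))) (e₂ μ q qb qv)) ⟩
    (N ^ qv) ^ (6 * (q * qb)) * (k ^ qb) ^ (6 * (μ * (q * qv)))
      ≤⟨ *-monoʳ-≤ ((N ^ qv) ^ (6 * (q * qb))) (^-monoˡ-≤ (6 * (μ * (q * qv))) (<⇒≤ k<)) ⟩
    (N ^ qv) ^ (6 * (q * qb)) * (2 ^ pb) ^ (6 * (μ * (q * qv)))
      <⟨ *-monoˡ-< ((2 ^ pb) ^ (6 * (μ * (q * qv)))) {{m^n≢0 (2 ^ pb) (6 * (μ * (q * qv))) {{m^n≢0 2 pb}}}}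
           (^-monoˡ-< (6 * (q * qb)) {{m*n≢0 6 (q * qb) {{_}} {{m*n≢0 q qb}}}} N<) ⟩
    (2 ^ pv) ^ (6 * (q * qb)) * (2 ^ pb) ^ (6 * (μ * (q * qv)))
      ≡⟨ cong₂ _*_ (^-*-assoc 2 pv (6 * (q * qb))) (^-*-assoc 2 pb (6 * (μ * (q * qv)))) ⟩
    2 ^ (pv * (6 * (q * qb))) * 2 ^ (pb * (6 * (μ * (q * qv))))
      ≡⟨ ^-distribˡ-+-* 2 (pv * (6 * (q * qb))) (pb * (6 * (μ * (q * qv)))) ⟨
    2 ^ (pv * (6 * (q * qb)) + pb * (6 * (μ * (q * qv))))
      ≡⟨ cong (2 ^_) (e₃ pv q qb pb μ qv) ⟩
    2 ^ (6 * (μ * pb * qv + pv * qb) * q)           ≤⟨ ^-monoʳ-≤ 2 exp≤ ⟩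
    2 ^ (p * (qb * qv))                             ≡⟨ ^-*-assoc 2 p (qb * qv) ⟨
    (2 ^ p) ^ (qb * qv)                             ∎)
  where
  open ≤-Reasoning
  ^-distribʳ-* : ∀ a b n → (a * b) ^ n ≡ a ^ n * b ^ n
  ^-distribʳ-* a b zero    = refl
  ^-distribʳ-* a b (suc n) = trans (cong (a * b *_) (^-distribʳ-* a b n)) (interchange a b (a ^ n) (b ^ n))
    where
    interchange : ∀ x y z w → x * y * (z * w) ≡ x * z * (y * w)
    interchange = solve-∀
  regroup : ∀ a x y z w → x * y ≡ z * w → (a ^ x) ^ y ≡ (a ^ z) ^ w
  regroup a x y z w eq = trans (^-*-assoc a x y) (trans (cong (a ^_) eq) (sym (^-*-assoc a z w)))
  e₁ : ∀ q b v → 6 * (q * (b * v)) ≡ v * (6 * (q * b))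
  e₁ = solve-∀
  e₂ : ∀ μ q b v → 6 * μ * (q * (b * v)) ≡ b * (6 * (μ * (q * v)))
  e₂ = solve-∀
  e₃ : ∀ pv q qb pb μ qv → pv * (6 * (q * qb)) + pb * (6 * (μ * (q * qv))) ≡ 6 * (μ * pb * qv + pv * qb) * q
  e₃ = solve-∀

-- An element `r` of the right-hand cut comes with an exponent `s = p / q` such that
-- `2 ^ p ≤ r ^ q`. If `r ≤ S`, this contradicts `S ^ q < 2 ^ p`, which holds because `s` is at
-- least `6 (μ b + v)` for some `b` above `log k` and `v` above `log N`.
size-bound : ∀ d {k μ N S} → μ ^ d < N → S ≤ N ^ 6 * k ^ (6 * μ) →
             fromℕ S ≤ʳ 2^ (fromℕ 6 *ʳ (root d N *ʳ log k +ʳ log N))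
-- Elements of a cut `log` are nonnegative, which excludes negative numerators, first for `log N`
-- and then for `log k`.
size-bound d _ _ r
  (_ , _ , (_ , _ , _ , (_ , mkℚᵘ ℤ.-[1+ _ ] _ , _ , (ℚ.*≤* () , _) , _) , _) , _)
size-bound d _ _ r
  (_ , _ , (_ , _ , _ , (_ , mkℚᵘ (ℤ.+ _) _ , (_ , mkℚᵘ ℤ.-[1+ _ ] _ , _ , (ℚ.*≤* () , _) , _) , _) , _) , _)
size-bound d {k} {μ} {N} {S} μ^d<N S≤ r
  (r≥0 , s ,
    (s₁ , s₂ , 6<s₁ ,
      (u , v@(mkℚᵘ (ℤ.+ pv) qv) ,
        (a , b@(mkℚᵘ (ℤ.+ pb) qb) , a∈root , (_ , k<) , a*b≤u) , (_ , N<) , u+v≤s₂) ,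
      s₁s₂≤s) ,
    2^p≤r^q) =
  ℚₚ.≰⇒> λ r≤S → <⇒≱ S^q<2^p (/1-≤⁻ (subst ((ℤ.+ (2 ^ ℤ.∣ ↥ s ∣) ℚ./ 1) ℚ.≤_) (fromℕ-^ S (↧ₙ s))
    (ℚₚ.≤-trans 2^p≤r^q (^ℚ-monoˡ-≤ (↧ₙ s) (ℚ.nonNegative r≥0) r≤S))))
  where
  M six : ℚᵘ
  M = ℤ.+ μ ℚ./ 1
  six = ℤ.+ 6 ℚ./ 1

  total = 6 * (μ * pb * suc qv + pv * suc qb)

  six*[M*b+v]≡ : six ℚ.* (M ℚ.* b ℚ.+ v) ≡ ℤ.+ total ℚ./ (suc qb * suc qv)
  six*[M*b+v]≡ = begin
    six ℚ.* (M ℚ.* b ℚ.+ v)              ≡⟨ cong (λ z → six ℚ.* (z ℚ.+ v)) (fromℕ-*-/ μ pb qb) ⟩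
    six ℚ.* (mkℚᵘ (ℤ.+ (μ * pb)) qb ℚ.+ v) ≡⟨ cong (six ℚ.*_) (/-+-/ (μ * pb) qb pv qv) ⟩
    six ℚ.* (ℤ.+ (μ * pb * suc qv + pv * suc qb) ℚ./ (suc qb * suc qv))
      ≡⟨ fromℕ-*-/ 6 (μ * pb * suc qv + pv * suc qb) (qv + qb * suc qv) ⟩
    ℤ.+ total ℚ./ (suc qb * suc qv)      ∎
    where open ≡-Reasoning

  M≤a : M ℚ.≤ a
  M≤a = root-≥ d μ^d<N a∈root

  total≤s : (ℤ.+ total ℚ./ (suc qb * suc qv)) ℚ.≤ s
  total≤s = begin
    ℤ.+ total ℚ./ (suc qb * suc qv)   ≡⟨ six*[M*b+v]≡ ⟨
    six ℚ.* (M ℚ.* b ℚ.+ v)           ≤⟨ ℚₚ.*-monoʳ-≤-nonNeg six (ℚₚ.+-monoˡ-≤ v (ℚₚ.*-monoˡ-≤-nonNeg b M≤a)) ⟩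
    six ℚ.* (a ℚ.* b ℚ.+ v)           ≤⟨ ℚₚ.*-monoʳ-≤-nonNeg six (ℚₚ.≤-trans (ℚₚ.+-monoˡ-≤ v a*b≤u) u+v≤s₂) ⟩
    six ℚ.* s₂                        ≤⟨ ℚₚ.*-monoˡ-≤-nonNeg s₂ {{s₂≥0}} (ℚₚ.<⇒≤ 6<s₁) ⟩
    s₁ ℚ.* s₂                         ≤⟨ s₁s₂≤s ⟩
    s                                 ∎
    where
    open ℚₚ.≤-Reasoning
    -- Multiplying `6 < s₁` by `s₂` requires this sign.
    s₂≥0 : ℚ.NonNegative s₂
    s₂≥0 = ℚₚ.nonNeg≤⇒nonNeg {mkℚᵘ (ℤ.+ (μ * pb * suc qv + pv * suc qb)) (qv + qb * suc qv)} (begin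
      ℤ.+ (μ * pb * suc qv + pv * suc qb) ℚ./ (suc qb * suc qv) ≡⟨ /-+-/ (μ * pb) qb pv qv ⟨
      mkℚᵘ (ℤ.+ (μ * pb)) qb ℚ.+ v    ≡⟨ cong (ℚ._+ v) (fromℕ-*-/ μ pb qb) ⟨
      M ℚ.* b ℚ.+ v                   ≤⟨ ℚₚ.+-monoˡ-≤ v (ℚₚ.*-monoˡ-≤-nonNeg b M≤a) ⟩
      a ℚ.* b ℚ.+ v                   ≤⟨ ℚₚ.+-monoˡ-≤ v a*b≤u ⟩
      u ℚ.+ v                         ≤⟨ u+v≤s₂ ⟩
      s₂                              ∎)

  S^q<2^p : S ^ ↧ₙ s < 2 ^ ℤ.∣ ↥ s ∣
  S^q<2^p = exponents-< {N} {k} {S} {μ} {pb} {suc qb} {pv} {suc qv} {ℤ.∣ ↥ s ∣} S≤ k< N<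
    (≤-nonNeg-fraction {total} {suc qb * suc qv} s total≤s)

-- Choice of the parameters

-- Linear search upwards from `a` for the first place where `P` switches on.
crossing : (P : ℕ → Set) → (∀ i → Dec (P i)) → ∀ a n → ¬ P a → P (a + n) →
           ∃[ i ] (a ≤ i × i < a + n × ¬ P i × P (suc i))
crossing P P? a zero    ¬Pa Pa+n = contradiction (subst P (+-identityʳ a) Pa+n) ¬Pa
crossing P P? a (suc n) ¬Pa Pa+n with P? (suc a)
... | yes P1+a = a , ≤-refl , m<m+n a z<s , ¬Pa , P1+a
... | no ¬P1+a with i , a<i , i<a+n , rest ← crossing P P? (suc a) n ¬P1+a (subst P (+-suc a n) Pa+n) =
  i , <⇒≤ a<i , subst (i <_) (sym (+-suc a n)) i<a+n , rest

n<b^n : ∀ b → 1 < b → ∀ n → n < b ^ n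
n<b^n b 1<b zero    = z<s
n<b^n b@(suc _) 1<b (suc n) = ≤-<-trans (n<b^n b 1<b n) (^-monoʳ-< b 1<b (n<1+n n))

m≤m^n : ∀ m n → 1 ≤ m → 1 ≤ n → m ≤ m ^ n
m≤m^n m@(suc _) n _ 1≤n = ≤-trans (≤-reflexive (sym (*-identityʳ m))) (^-monoʳ-≤ m 1≤n)

integerRoot : ∀ d N → 2 ≤ d → 2 ≤ N → ∃[ μ ] (1 ≤ μ × μ ^ d < N × N ≤ suc μ ^ d)
integerRoot d N 2≤d 2≤N
  with crossing (λ μ → N ≤ suc μ ^ d) (λ μ → N ≤? suc μ ^ d) 0 N
         (<⇒≱ (≤-trans (s≤s (≤-reflexive (^-zeroˡ d))) 2≤N))
         (≤-trans (n≤1+n N) (m≤m^n (suc N) d z<s (<⇒≤ 2≤d)))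
-- The predicate concerns `suc μ`, so the search ends with `(j + 1) ^ d < N ≤ (j + 2) ^ d`; thus
-- `suc j` is the root rounded up, minus 1.
... | j , _ , _ , N≰ , N≤ = suc j , z<s , ≰⇒> N≰ , N≤

binaryLog : ∀ k → 2 ≤ k → ∃[ g ] (1 ≤ g × 2 ^ g ≤ k × k < 2 ^ suc g)
binaryLog k 2≤k
  with crossing (λ g → k < 2 ^ g) (λ g → k <? 2 ^ g) 1 k (≤⇒≯ 2≤k)
         (<-trans (n<b^n 2 ≤-refl k) (^-monoʳ-< 2 ≤-refl (n<1+n k)))
... | g , 1≤g , _ , k≮ , k< = g , 1≤g , ≮⇒≥ k≮ , k<

layerCount : ∀ d m N → 2 ≤ d → m ≤ N → N ≤ m ^ d →
             ∃[ ρ ] (2 + ρ ≤ d × m ^ suc ρ ≤ N × N ≤ m ^ (2 + ρ))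
layerCount d m N 2≤d m≤N N≤m^d with N ≤? m ^ 2
... | yes N≤m² = 0 , 2≤d , ≤-trans (≤-reflexive (*-identityʳ m)) m≤N , N≤m²
... | no N≰m²
  with crossing (λ r → N ≤ m ^ r) (λ r → N ≤? m ^ r) 2 (d ∸ 2) N≰m²
         (subst (λ z → N ≤ m ^ z) (sym (m+[n∸m]≡n 2≤d)) N≤m^d)
...   | suc r , s≤s _ , r<d , N≰m^r , N≤ = r , subst (suc r <_) (m+[n∸m]≡n 2≤d) r<d , <⇒≤ (≰⇒> N≰m^r) , N≤

-- Input columns and assembly of the circuit.

digit-inputs : ∀ {V M k} (h : Fin M × Fin k → Input V) x j →
  digit {M} {k} (eval (inputs (h ∘ remQuot {M} k)) x) j ≡ ∑[ i < k ] bit (inputValue x (h (j , i)))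
digit-inputs {k = k} h x j =
  sum-cong-≗ {k} (λ i → cong (λ u → bit (inputValue x (h u))) (remQuot-combine j i))

-- Zero columns appended on the least significant side scale SUM by a power of 2.
paddedInputs : ∀ k N M → N ≤ M → ∃[ f ] (∀ x →
  2 ^ M ≤ positional 2 M (digit {M} {k} (eval (inputs f) x)) ⇔ 2 ^ N ≤ SUM k N x)
paddedInputs k N M N≤M with e , refl ← m≤n⇒∃[o]m+o≡n N≤M = column ∘ remQuot {N + e} k , correct
  where
  column : Fin (N + e) × Fin k → Input (Fin k × Fin N)
  column (j , i) = [ (λ j′ → var (i , j′)) , (λ _ → const false) ]′ (splitAt N j)

  module _ (x : Fin k × Fin N → Bool) where
    digits : Fin (N + e) → ℕ
    digits = digit {N + e} {k} (eval (inputs (column ∘ remQuot {N + e} k)) x)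

    digits-↑ˡ : ∀ j → digits (j ↑ˡ e) ≡ ∑[ i < k ] bit (x (i , j))
    digits-↑ˡ j = trans (digit-inputs column x (j ↑ˡ e))
      (sum-cong-≗ {k} λ i → cong (bit ∘ inputValue x ∘ [ _ , _ ]′) (splitAt-↑ˡ N j e))

    digits-↑ʳ : ∀ j → digits (N ↑ʳ j) ≡ 0
    digits-↑ʳ j = trans (digit-inputs column x (N ↑ʳ j))
      (trans (sum-cong-≗ {k} λ i → cong (bit ∘ inputValue x ∘ [ _ , _ ]′) (splitAt-↑ʳ N e j))
             (sum-replicate-zero k))

    positional-zero : positional 2 e (digits ∘ (N ↑ʳ_)) ≡ 0
    positional-zero = trans
      (sum-cong-≗ {e} λ j → trans (cong (2 ^ (e ∸ suc (toℕ j)) *_) (digits-↑ʳ j))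
                            (*-zeroʳ (2 ^ (e ∸ suc (toℕ j)))))
      (sum-replicate-zero e)

    positional-digits : positional 2 (N + e) digits ≡ 2 ^ e * SUM k N x
    positional-digits = begin
      positional 2 (N + e) digits
        ≡⟨ positional-++ 2 N e digits ⟩
      2 ^ e * positional 2 N (digits ∘ (_↑ˡ e)) + positional 2 e (digits ∘ (N ↑ʳ_))
        ≡⟨ cong₂ (λ p q → 2 ^ e * p + q) (positional-cong 2 N digits-↑ˡ) positional-zero ⟩
      2 ^ e * SUM k N x + 0
        ≡⟨ +-identityʳ (2 ^ e * SUM k N x) ⟩
      2 ^ e * SUM k N x ∎
      where open ≡-Reasoning

    correct : 2 ^ (N + e) ≤ positional 2 (N + e) digits ⇔ 2 ^ N ≤ SUM k N x
    correct rewrite positional-digits | trans (^-distribˡ-+-* 2 N e) (*-comm (2 ^ N) (2 ^ e)) =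
      mk⇔ (*-cancelˡ-≤ (2 ^ e) {{m^n≢0 2 e}}) (*-monoʳ-≤ (2 ^ e))

-- The first layer reads blocks of `M` binary columns, the later ones blocks of `ℓ` digits in base
-- `k`. Here `g` is `log k` rounded down.
module Construction (κ N μ g ρ : ℕ) (1≤κ : 1 ≤ κ) (1≤μ : 1 ≤ μ) (1≤g : 1 ≤ g)
                    (2^g≤k : 2 ^ g ≤ suc κ) (k<2^1+g : suc κ < 2 ^ suc g)
                    (ℓ^1+ρ≤N : suc μ ^ suc ρ ≤ N) (N≤ℓ^2+ρ : N ≤ suc μ ^ (2 + ρ)) where
  k = suc κ
  ℓ = suc μ
  K = κ * k
  M = ℓ * g

  private
    u₀ : Fin K
    u₀ = fromℕ< {0} (*-mono-≤ 1≤κ (s≤s (z≤n {κ})))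

    2≤ℓ : 2 ≤ ℓ
    2≤ℓ = s≤s 1≤μ

    ℓ≤M : ℓ ≤ M
    ℓ≤M = ≤-trans (≤-reflexive (sym (*-identityʳ ℓ))) (*-monoʳ-≤ ℓ 1≤g)

    1+g≤M : suc g ≤ M
    1+g≤M = ≤-trans (+-mono-≤ 1≤g (≤-reflexive (sym (+-identityʳ g)))) (*-monoˡ-≤ g 2≤ℓ)

    -- Compression to base `k` requires this; `2 ≤ ℓ` makes up for the rounding of `g`.
    k≤2^M : k ≤ 2 ^ M
    k≤2^M = ≤-trans (<⇒≤ k<2^1+g) (^-monoʳ-≤ 2 1+g≤M)

    -- As `g` is rounded down, the wire bound of the later gates also covers the first layer.
    2^M≤k^ℓ : 2 ^ M ≤ k ^ ℓ
    2^M≤k^ℓ = ≤-trans (≤-reflexive (trans (cong (2 ^_) (*-comm ℓ g)) (sym (^-*-assoc 2 g ℓ))))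
      (^-monoˡ-≤ ℓ 2^g≤k)

    -- A binary column has `k` bits, so its sum is at most `k (2 − 1)`.
    k+k≤k*2 : k + k ≤ k * 2
    k+k≤k*2 = ≤-reflexive (trans (cong (k +_) (sym (+-identityʳ k))) (*-comm 2 k))

    module First = Reduce κ 2 M (fromℕ< {0} (≤-trans z<s ℓ≤M)) {k} zero k≤2^M k+k≤k*2 u₀
    module Rest = Complete κ ℓ zero u₀

    digits≡ : ∀ r → Rest.digits r ≡ ℓ ^ suc r
    digits≡ zero    = sym (*-identityʳ ℓ)
    digits≡ (suc r) = trans (cong (_* ℓ) (digits≡ r)) (*-comm (ℓ ^ suc r) ℓ)

    N≤digits*M : N ≤ Rest.digits ρ * M
    N≤digits*M = begin
      N                       ≤⟨ N≤ℓ^2+ρ ⟩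
      ℓ * ℓ ^ suc ρ           ≡⟨ *-comm ℓ (ℓ ^ suc ρ) ⟩
      ℓ ^ suc ρ * ℓ           ≤⟨ *-monoʳ-≤ (ℓ ^ suc ρ) ℓ≤M ⟩
      ℓ ^ suc ρ * M           ≡⟨ cong (_* M) (digits≡ ρ) ⟨
      Rest.digits ρ * M       ∎
      where open ≤-Reasoning

    pad = paddedInputs k N (Rest.digits ρ * M) N≤digits*M

    l₀ : Layered (Fin k × Fin N) (Rest.digits ρ * M * k)
    l₀ = inputs (proj₁ pad)

    l₁ : Layered (Fin k × Fin N) (Rest.digits ρ * K)
    l₁ = First.reduce (Rest.digits ρ) l₀

  circuit : Layered (Fin k × Fin N) 1
  circuit = Rest.complete ρ l₁

  circuit-covered : Covered circuit
  circuit-covered = Rest.complete-covered ρ (First.reduce-covered (Rest.digits ρ) {l₀} _)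

  height-circuit : height circuit ≡ 2 + ρ
  height-circuit = trans (Rest.height-complete ρ l₁) (+-comm (suc ρ) 1)

  eval-circuit : ∀ x → eval circuit x zero ≡ U k N x
  eval-circuit x = trans (Rest.eval-complete ρ l₁ x)
    (⌊⌋-cong (_ ≤? _) (_ ≤? _)
      (⇔-trans (⇔-sym (First.reduce-overflow (Rest.digits ρ) l₀ x)) (proj₂ pad x)))

  -- Each of the `2 + ρ ≤ N` layers has at most `W` wires, the bound for `N k ^ 2` gates of
  -- `k ^ (1 + ℓ)` wires dominating `W`. With `ℓ = suc μ` the total is at most `N ^ 2 k ^ (4 + μ)`,
  -- and `1 ≤ μ` absorbs the 4.
  wires-circuit : wires circuit ≤ N ^ 6 * k ^ (6 * μ)
  wires-circuit = begin
    wires circuit                                  ≤⟨ Rest.wires-complete ρ ≤-refl l₁ ⟩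
    suc ρ * W + wires l₁                           ≤⟨ +-monoʳ-≤ (suc ρ * W) (First.wires-reduce (Rest.digits ρ) l₀) ⟩
    suc ρ * W + (Rest.digits ρ * K * (k * 2 ^ M) + 0)
      ≡⟨ cong (suc ρ * W +_) (+-identityʳ _) ⟩
    suc ρ * W + Rest.digits ρ * K * (k * 2 ^ M)
      ≤⟨ +-monoʳ-≤ (suc ρ * W) (*-monoʳ-≤ (Rest.digits ρ * K) (*-monoʳ-≤ k 2^M≤k^ℓ)) ⟩
    suc ρ * W + W                                  ≡⟨ +-comm (suc ρ * W) W ⟩
    (2 + ρ) * W                                    ≤⟨ *-mono-≤ 2+ρ≤N W≤ ⟩
    N * (N * (k * k) * (k * k ^ ℓ))                ≡⟨ regroup N k (k ^ μ) ⟩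
    N ^ 2 * (k ^ 4 * k ^ μ)                        ≡⟨ cong (N ^ 2 *_) (^-distribˡ-+-* k 4 μ) ⟨
    N ^ 2 * k ^ (4 + μ)                            ≤⟨ *-mono-≤ (^-monoʳ-≤ N {{N≢0}} 2≤6) (^-monoʳ-≤ k 4+μ≤6μ) ⟩
    N ^ 6 * k ^ (6 * μ)                            ∎
    where
    open ≤-Reasoning
    W = Rest.digits ρ * K * (k * k ^ ℓ)
    digits≤N : Rest.digits ρ ≤ N
    digits≤N = ≤-trans (≤-reflexive (digits≡ ρ)) ℓ^1+ρ≤N
    2+ρ≤N : 2 + ρ ≤ N
    2+ρ≤N = ≤-trans (n<b^n ℓ 2≤ℓ (suc ρ)) ℓ^1+ρ≤N
    N≢0 : NonZero N
    N≢0 = >-nonZero (≤-trans z<s 2+ρ≤N)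
    W≤ : W ≤ N * (k * k) * (k * k ^ ℓ)
    W≤ = *-monoˡ-≤ (k * k ^ ℓ) (*-mono-≤ digits≤N (*-monoˡ-≤ k (n≤1+n κ)))
    2≤6 : 2 ≤ 6
    2≤6 = s≤s (s≤s z≤n)
    4+μ≤6μ : 4 + μ ≤ 6 * μ
    4+μ≤6μ = ≤-trans (+-monoˡ-≤ μ (*-monoʳ-≤ 4 1≤μ))
      (≤-trans (≤-reflexive (+-comm (4 * μ) μ)) (m≤n+m (5 * μ) μ))
    regroup : ∀ N k p → N * (N * (k * k) * (k * (k * p))) ≡ N * (N * 1) * (k * (k * (k * (k * 1))) * p)
    regroup = solve-∀

theorem2 : (k d N : ℕ) → k ≥ 2 → d ≥ 2 → N ≥ 2 →
    ∃[ C ] (Circuit.Depth≤ {Fin k × Fin N} C d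
    × fromℕ (Circuit.size C) ≤ʳ 2^ (fromℕ 6 *ʳ (root d N *ʳ log k +ʳ log N))
    × Circuit.Computes C (U k N))
theorem2 k@(suc κ) d N k≥2 d≥2 N≥2
  with μ , 1≤μ , μ^d<N , N≤m^d ← integerRoot d N d≥2 N≥2
  with g , 1≤g , 2^g≤k , k<2^1+g ← binaryLog k k≥2
  with ρ , 2+ρ≤d , m^1+ρ≤N , N≤m^2+ρ ←
    -- The bound `suc μ ≤ N` comes from `μ ≤ μ ^ d < N`.
    layerCount d (suc μ) N d≥2 (≤-<-trans (m≤m^n μ d 1≤μ (<⇒≤ d≥2)) μ^d<N) N≤m^d =
  toCircuit circuit circuit-covered ,
  (λ eq p → ≤-trans (depth-toCircuit circuit circuit-covered eq p)
              (≤-trans (≤-reflexive height-circuit) 2+ρ≤d)) ,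
  size-bound d {k} {μ} μ^d<N (≤-trans (≤-reflexive (size-toCircuit circuit circuit-covered)) wires-circuit) ,
  (λ x → trans (value-toCircuit circuit circuit-covered x) (eval-circuit x))
  where open Construction κ N μ g ρ (s≤s⁻¹ k≥2) 1≤μ 1≤g 2^g≤k k<2^1+g m^1+ρ≤N N≤m^2+ρ
          using (circuit; circuit-covered; height-circuit; eval-circuit; wires-circuit)
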